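{- Let $\lambda\in\mathbb{R}$ and $r\in\mathbb{N}\cup\{0\}$. For every integer $n\ge0$, the following identity holds (as polynomials in the variable $x$): $$Bel_{n,\lambda}^{(r)}(x)=\sum_{k=0}^{n}\sum_{m=0}^{k}\binom{n}{k}\,Bel_{n-k,\lambda}(x)\,\lambda^{k-m}\,r^m\,S_1(k,m).$$
   Context: All generating functions are formal power series in $t$. For a number $y$, $(1+\lambda t)^{y/\lambda}$ denotes the formal power series $\sum_{n\ge0}(y|\lambda)_n\frac{t^n}{n!}$, where $(y|\lambda)_0=1$ and $(y|\lambda)_n=y(y-\lambda)(y-2\lambda)\cdots(y-(n-1)\lambda)$ for $n\ge1$ (for $\lambda=0$ this is the limit $e^{yt}$). The convention $0^0=1$ is used. The (signed) Stirling numbers of the first kind $S_1(n,k)$ are defined by $(x)_n=\sum_{k=0}^n S_1(n,k)x^k$, where $(x)_0=1$ and $(x)_n=x(x-1)\cdots(x-n+1)$ for $n\ge1$. The degenerate Bell polynomials $Bel_{n,\lambda}(x)$ are defined by $$e^{x\left((1+\lambda t)^{1/\lambda}-1\right)}=\sum_{n=0}^\infty Bel_{n,\lambda}(x)\frac{t^n}{n!}.$$ The extended degenerate Bell polynomials $Bel_{n,\lambda}^{(r)}(x)$ are defined by $$(1+\lambda t)^{r/\lambda}\,e^{x\left((1+\lambda t)^{1/\lambda}-1\right)}=\sum_{n=0}^\infty Bel_{n,\lambda}^{(r)}(x)\frac{t^n}{n!}.$$ -}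

module Defs where

open import Algebra.Bundles using (RawMonoid; RawRing; CommutativeRing)
import Algebra.Definitions.RawMonoid as RawMonoidDefs
import Algebra.Definitions.RawSemiring as RawSemiringDefs
open import Data.Fin.Base using (toℕ)
open import Data.Integer.Base as ℤ using (ℤ; +_; -[1+_])
open import Data.List.Base using (List; []; _∷_; map)
open import Data.Nat.Base using (ℕ; zero; suc; _∸_; _!; NonZero)
open import Data.Nat.Properties using (_!≢0)
open import Level using (_⊔_) renaming (suc to lsuc)

-- A commutative ring in which every positive integer is invertible.  Real
-- numbers, in any construction, are an instance.  The chosen inverses are
-- determined up to _≈_ by 1/-inverse.
record ℚAlgebra c ℓ : Set (lsuc (c ⊔ ℓ)) where
  field
    commutativeRing : CommutativeRing c ℓ
  open CommutativeRing commutativeRing public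
  open RawMonoidDefs (RawRing.+-rawMonoid rawRing) using (_×_)
  field
    1/_        : (n : ℕ) .{{_ : NonZero n}} → Carrier
    1/-inverse : (n : ℕ) .{{_ : NonZero n}} → (n × 1#) * (1/ n) ≈ 1#

module FiniteSum {c ℓ} (M : RawMonoid c ℓ) where
  open RawMonoid M using (Carrier)
  open RawMonoidDefs M using (sum)

  ∑≤ : ℕ → (ℕ → Carrier) → Carrier
  ∑≤ n f = sum {suc n} (λ i → f (toℕ i))

  infixl 10 ∑≤
  syntax ∑≤ n (λ i → e) = ∑[ i ≤ n ] e

module RingExtras {c ℓ} (R : RawRing c ℓ) where
  open RawRing R
  open RawSemiringDefs rawSemiring public using (_×_; _^_)

  -- (y ∣ l)ₙ = y (y - l) (y - 2l) ⋯ (y - (n-1)l)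
  falling : Carrier → Carrier → ℕ → Carrier
  falling y l zero    = 1#
  falling y l (suc n) = falling y l n * (y + - (n × l))

  fromℕ : ℕ → Carrier
  fromℕ n = n × 1#

  fromℤ : ℤ → Carrier
  fromℤ (+ n)    = fromℕ n
  fromℤ -[1+ n ] = - fromℕ (suc n)

-- Polynomials in one variable, as coefficient lists starting with the
-- constant term.  Trailing zeros are allowed, so lists are compared by their
-- coefficients.
module Polynomial {c ℓ} (R : RawRing c ℓ) where
  open RawRing R

  Poly : Set c
  Poly = List Carrier

  coeff : Poly → ℕ → Carrier
  coeff []      k       = 0#
  coeff (a ∷ p) zero    = a
  coeff (a ∷ p) (suc k) = coeff p k

  infix 4 _≈ₚ_
  _≈ₚ_ : Poly → Poly → Set ℓ
  p ≈ₚ q = ∀ k → coeff p k ≈ coeff q k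

  infixl 6 _+ₚ_
  _+ₚ_ : Poly → Poly → Poly
  []      +ₚ q       = q
  (a ∷ p) +ₚ []      = a ∷ p
  (a ∷ p) +ₚ (b ∷ q) = (a + b) ∷ (p +ₚ q)

  infixl 7 _*ₚ_
  _*ₚ_ : Poly → Poly → Poly
  []      *ₚ q = []
  (a ∷ p) *ₚ q = map (a *_) q +ₚ (0# ∷ (p *ₚ q))

  con : Carrier → Poly
  con a = a ∷ []

  X : Poly
  X = 0# ∷ 1# ∷ []

  polyRing : RawRing c ℓ
  polyRing = record
    { Carrier = Poly
    ; _≈_     = _≈ₚ_
    ; _+_     = _+ₚ_
    ; _*_     = _*ₚ_
    ; -_      = map (-_)
    ; 0#      = []
    ; 1#      = con 1#
    }

-- Formal power series in t over R; the value at n is the coefficient of tⁿ.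
-- The parameter 1/! n plays the role of the scalar 1/n! in R.
module PowerSeries {c ℓ} (R : RawRing c ℓ) (1/! : ℕ → RawRing.Carrier R) where
  open RawRing R
  open RingExtras R using (_×_)
  open FiniteSum +-rawMonoid

  Series : Set c
  Series = ℕ → Carrier

  const : Carrier → Series
  const a zero    = a
  const a (suc n) = 0#

  seriesRing : RawRing c ℓ
  seriesRing = record
    { Carrier = Series
    ; _≈_     = λ f g → ∀ n → f n ≈ g n
    ; _+_     = λ f g n → f n + g n
    ; _*_     = λ f g n → ∑[ k ≤ n ] (f k * g (n ∸ k))
    ; -_      = λ f n → - f n
    ; 0#      = λ _ → 0#
    ; 1#      = const 1#
    }

  open RingExtras seriesRing using () renaming (_^_ to _^ₛ_)

  -- ∑ₙ aₙ tⁿ/n!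
  egf : (ℕ → Carrier) → Series
  egf a n = a n * 1/! n

  -- The sequence a with f = ∑ₙ aₙ tⁿ/n!
  egfCoeff : Series → ℕ → Carrier
  egfCoeff f n = (n !) × f n

  -- ∑ₖ fᵏ/k!, for f with zero constant term: then fᵏ does not contribute to
  -- the coefficient of tⁿ when k > n.
  exp : Series → Series
  exp f n = ∑[ k ≤ n ] (1/! k * (f ^ₛ k) n)

-- Signed Stirling numbers of the first kind: the coefficient of xᵏ in the
-- falling factorial x (x - 1) ⋯ (x - n + 1) ∈ ℤ[x].
S₁ : ℕ → ℕ → ℤ
S₁ n k = coeff (falling X (RawRing.1# polyRing) n) k
  where
  open Polynomial ℤ.+-*-rawRing
  open RingExtras polyRing

module DegenerateBell {c ℓ} (A : ℚAlgebra c ℓ) where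
  open ℚAlgebra A using (1#; 1/_; rawRing) public renaming (Carrier to Scalar)
  open RingExtras rawRing using (falling; _^_; fromℕ; fromℤ) public
  open Polynomial rawRing using (Poly; con; X; polyRing) public
  open RawRing polyRing using (_≈_; _*_; +-rawMonoid) public
  open RingExtras polyRing using (_×_) public
  open FiniteSum +-rawMonoid public

  open PowerSeries polyRing (λ n → con ((1/ (n !)) {{n !≢0}})) public

  private module S = RawRing seriesRing

  -- (1 + l t)^(y/l)
  degExp : Scalar → Scalar → Series
  degExp l y = egf (λ n → con (falling y l n))

  -- e^(x ((1 + l t)^(1/l) - 1))
  bellSeries : Scalar → Series
  bellSeries l = exp (const X S.* (degExp l 1# S.+ S.- S.1#))

  Bel : Scalar → ℕ → Poly
  Bel l = egfCoeff (bellSeries l)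

  -- extBel l r n is the extended polynomial with superscript r, index n.
  extBel : Scalar → ℕ → ℕ → Poly
  extBel l r = egfCoeff (degExp l (fromℕ r) S.* bellSeries l)

{-# OPTIONS --safe #-}

-- Multiplying exponential generating functions gives
-- Bel⁽ʳ⁾ₙ = ∑ₖ (n C k) Belₙ₋ₖ (r ∣ λ)ₖ, and (r ∣ λ)ₖ is the homogenization
-- ∑ₘ λᵏ⁻ᵐ rᵐ S₁(k, m) of the falling factorial.  Every factor other than the
-- Bell polynomials is a scalar, so all of this is checked coefficient by
-- coefficient in x.
module Submission where

open import Algebra.Bundles using (CommutativeRing; RawRing)
import Algebra.Properties.CommutativeMonoid.Mult as CommutativeMonoidMult
import Algebra.Properties.Ring as RingProperties
import Algebra.Properties.Semiring.Mult as SemiringMult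
import Algebra.Properties.Semiring.Sum as SemiringSum
import Algebra.Solver.Ring.NaturalCoefficients.Default as SemiringSolver
open import Data.Fin.Base using (toℕ)
open import Data.Fin.Properties using (toℕ≤pred[n])
open import Data.Integer.Base as ℤ using (+_; -[1+_]; _⊖_)
import Data.Integer.Properties as ℤ
open import Data.List.Base using ([]; _∷_; map)
open import Data.Nat.Base as ℕ using (ℕ; zero; suc; _∸_; _!; _≤_; _<_; s≤s)
open import Data.Nat.Combinatorics using (_C_; k![n∸k]!∣n!; nCk≡n!/k![n-k]!)
open import Data.Nat.DivMod using (m/n*n≡m)
import Data.Nat.Properties as ℕ
open import Data.Nat.Properties using (_!≢0; _!*_!≢0)
open import Relation.Binary.PropositionalEquality as ≡ using (_≡_)
import Relation.Binary.Reasoning.Setoid as SetoidReasoning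
open import Defs

-- The quotient defining the binomial coefficient is exact, so it can be multiplied back. With `k !`
-- as the last factor, `k !` can be split off first to cancel an inverse factorial.
nCk*[n∸k]!*k!≡n! : ∀ {n k} → k ≤ n → (n C k) ℕ.* (n ∸ k) ! ℕ.* k ! ≡ n !
nCk*[n∸k]!*k!≡n! {n} {k} k≤n = begin
  (n C k) ℕ.* (n ∸ k) ! ℕ.* k !    ≡⟨ ℕ.*-assoc (n C k) _ _ ⟩
  (n C k) ℕ.* ((n ∸ k) ! ℕ.* k !)  ≡⟨ ≡.cong₂ ℕ._*_ (nCk≡n!/k![n-k]! k≤n) (ℕ.*-comm ((n ∸ k) !) _) ⟩
  _                                ≡⟨ m/n*n≡m {{k !* n ∸ k !≢0}} (k![n∸k]!∣n! k≤n) ⟩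
  n !                              ∎
  where open ≡.≡-Reasoning

-- Coefficients of sums, products and multiples of polynomials.

module PolynomialCoefficients {c ℓ} (R : CommutativeRing c ℓ) where
  open CommutativeRing R
  open Polynomial rawRing
  open RingExtras polyRing using () renaming (_×_ to _×ₚ_)
  open SemiringMult semiring using (_×_)
  open FiniteSum (CommutativeRing.+-rawMonoid R) using (∑≤)
  open FiniteSum (RawRing.+-rawMonoid polyRing) using () renaming (∑≤ to ∑≤ₚ)
  open SetoidReasoning setoid

  shift : (ℕ → Carrier) → ℕ → Carrier
  shift f zero    = 0#
  shift f (suc n) = f n

  coeff-+ₚ : ∀ p q j → coeff (p +ₚ q) j ≈ coeff p j + coeff q j
  coeff-+ₚ []      q       j       = sym (+-identityˡ _)
  coeff-+ₚ (a ∷ p) []      j       = sym (+-identityʳ _)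
  coeff-+ₚ (a ∷ p) (b ∷ q) zero    = refl
  coeff-+ₚ (a ∷ p) (b ∷ q) (suc j) = coeff-+ₚ p q j

  coeff-scale : ∀ a p j → coeff (map (a *_) p) j ≈ a * coeff p j
  coeff-scale a []      j       = sym (zeroʳ a)
  coeff-scale a (b ∷ p) zero    = refl
  coeff-scale a (b ∷ p) (suc j) = coeff-scale a p j

  coeff-con-*ₚ : ∀ a p j → coeff (con a *ₚ p) j ≈ a * coeff p j
  coeff-con-*ₚ a p j = begin
    coeff (map (a *_) p +ₚ con 0#) j           ≈⟨ coeff-+ₚ (map (a *_) p) (con 0#) j ⟩
    coeff (map (a *_) p) j + coeff (con 0#) j  ≈⟨ +-cong (coeff-scale a p j) (coeff-con0 j) ⟩
    a * coeff p j + 0#                         ≈⟨ +-identityʳ _ ⟩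
    a * coeff p j                              ∎
    where
    coeff-con0 : ∀ j → coeff (con 0#) j ≈ 0#
    coeff-con0 zero    = refl
    coeff-con0 (suc j) = refl

  coeff-*ₚ-con : ∀ p a j → coeff (p *ₚ con a) j ≈ coeff p j * a
  coeff-*ₚ-con []      a j       = sym (zeroˡ a)
  coeff-*ₚ-con (b ∷ p) a zero    = +-identityʳ _
  coeff-*ₚ-con (b ∷ p) a (suc j) = coeff-*ₚ-con p a j

  -- Multiplying by a + x scales by a and moves every coefficient up one place. The factors x - n of
  -- the falling factorial have this shape.
  coeff-*ₚ-linear : ∀ p a j →
    coeff (p *ₚ (a ∷ 1# ∷ [])) j ≈ coeff p j * a + shift (coeff p) j
  coeff-*ₚ-linear []      a zero    = sym (trans (+-identityʳ _) (zeroˡ a))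
  coeff-*ₚ-linear []      a (suc j) = sym (trans (+-identityʳ _) (zeroˡ a))
  coeff-*ₚ-linear (b ∷ p) a zero    = refl
  coeff-*ₚ-linear (b ∷ p) a (suc j) = begin
    -- `con (b * 1#)` is what is left of `b` times the linear factor after its constant term. It
    -- supplies the shifted coefficient `b` at `j` = 0 and nothing beyond.
    coeff (con (b * 1#) +ₚ p *ₚ (a ∷ 1# ∷ [])) j            ≈⟨ coeff-+ₚ (con (b * 1#)) (p *ₚ (a ∷ 1# ∷ [])) j ⟩
    coeff (con (b * 1#)) j + coeff (p *ₚ (a ∷ 1# ∷ [])) j   ≈⟨ +-congˡ (coeff-*ₚ-linear p a j) ⟩
    coeff (con (b * 1#)) j + (coeff p j * a + shift (coeff p) j) ≈⟨ rearrange j ⟩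
    coeff p j * a + coeff (b ∷ p) j                          ∎
    where
    rearrange : ∀ j → coeff (con (b * 1#)) j + (coeff p j * a + shift (coeff p) j)
                      ≈ coeff p j * a + coeff (b ∷ p) j
    rearrange zero    = trans (+-comm _ _) (+-cong (+-identityʳ _) (*-identityʳ b))
    rearrange (suc j) = +-identityˡ _

  coeff-× : ∀ n p j → coeff (n ×ₚ p) j ≈ n × coeff p j
  coeff-× zero    p j = refl
  coeff-× (suc n) p j = trans (coeff-+ₚ p (n ×ₚ p) j) (+-congˡ (coeff-× n p j))

  coeff-∑≤ : ∀ n (f : ℕ → Poly) j → coeff (∑≤ₚ n f) j ≈ ∑≤ n (λ k → coeff (f k) j)
  coeff-∑≤ zero    f j = coeff-+ₚ (f 0) [] j
  coeff-∑≤ (suc n) f j =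
    trans (coeff-+ₚ (f 0) _ j) (+-congˡ (coeff-∑≤ n (λ k → f (suc k)) j))

-- Recurrence and vanishing of the Stirling numbers of the first kind.

open PolynomialCoefficients ℤ.+-*-commutativeRing using () renaming (shift to shiftℤ)

-- Coefficient comparison in (x)ₙ₊₁ = (x)ₙ (x - n), where the shift accounts for the multiplication
-- by x.
S₁-suc : ∀ n m → S₁ (suc n) m ≡ S₁ n m ℤ.* ℤ.- (+ n) ℤ.+ shiftℤ (S₁ n) m
S₁-suc n m = begin
  S₁ (suc n) m                                     ≡⟨ ≡.cong (λ q → coeff (p *ₚ q) m) (factor n) ⟩
  coeff (p *ₚ (ℤ.- (+ n) ∷ + 1 ∷ [])) m            ≡⟨ coeff-*ₚ-linear p (ℤ.- (+ n)) m ⟩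
  S₁ n m ℤ.* ℤ.- (+ n) ℤ.+ shiftℤ (S₁ n) m         ∎
  where
  open ≡.≡-Reasoning
  open PolynomialCoefficients ℤ.+-*-commutativeRing using (coeff-*ₚ-linear)
  open Polynomial ℤ.+-*-rawRing
  open RingExtras polyRing using (falling; _×_)

  p : Poly
  p = falling X (con (+ 1)) n

  -- Starts at 1 because `zero × con (+ 1)` is the empty list and not `con (+ 0)`. Integer
  -- arithmetic computes, so `factor` can be an equality of lists and not merely of coefficients.
  suc×1 : ∀ n → suc n × con (+ 1) ≡ con (+ suc n)
  suc×1 zero    = ≡.refl
  suc×1 (suc n) = ≡.cong (con (+ 1) +ₚ_) (suc×1 n)

  factor : ∀ n → X +ₚ map ℤ.-_ (n × con (+ 1)) ≡ ℤ.- (+ n) ∷ + 1 ∷ []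
  factor zero    = ≡.refl
  factor (suc n) = ≡.cong (λ q → X +ₚ map ℤ.-_ q) (suc×1 n)

-- (x)ₙ has degree n: in the recurrence, each new factor raises the degree by at most one.
n<m⇒S₁≡0 : ∀ {n m} → n < m → S₁ n m ≡ + 0
n<m⇒S₁≡0 {zero}  {suc m} _         = ≡.refl
n<m⇒S₁≡0 {suc n} {suc m} (s≤s n<m) = begin
  S₁ (suc n) (suc m)                       ≡⟨ S₁-suc n (suc m) ⟩
  S₁ n (suc m) ℤ.* ℤ.- (+ n) ℤ.+ S₁ n m    ≡⟨ ≡.cong₂ (λ i j → i ℤ.* ℤ.- (+ n) ℤ.+ j)
                                                (n<m⇒S₁≡0 (ℕ.m<n⇒m<1+n n<m)) (n<m⇒S₁≡0 n<m) ⟩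
  + 0                                      ∎
  where open ≡.≡-Reasoning

-- Falling factorials as homogenized Stirling sums in a commutative ring.

module FallingExpansion {c ℓ} (R : CommutativeRing c ℓ) where
  open CommutativeRing R
  open RingExtras rawRing using (falling; fromℕ; fromℤ; _^_)
  open PolynomialCoefficients R using (shift)
  open RingProperties ring
  open SemiringMult semiring
  open SemiringSum semiring using (sum-cong-≋; ∑-distrib-+; *-distribˡ-sum)
  open FiniteSum (CommutativeRing.+-rawMonoid R)
  open SemiringSolver commutativeSemiring using (solve; _:=_; _:+_; _:*_)
  open SetoidReasoning setoid

  fromℤ-neg : ∀ i → fromℤ (ℤ.- i) ≈ - fromℤ i
  fromℤ-neg (+ zero)  = sym -0#≈0#
  fromℤ-neg (+ suc n) = refl
  fromℤ-neg -[1+ n ]  = sym (-‿involutive _)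

  -- Integer addition with mixed signs computes to `⊖`, so this is the mixed case of additivity.
  fromℤ-⊖ : ∀ m n → fromℤ (m ⊖ n) ≈ fromℕ m - fromℕ n
  fromℤ-⊖ m       zero    = sym (trans (+-congˡ -0#≈0#) (+-identityʳ _))
  fromℤ-⊖ zero    (suc n) = sym (+-identityˡ _)
  fromℤ-⊖ (suc m) (suc n) = begin
    fromℤ (suc m ⊖ suc n)                   ≡⟨ ≡.cong fromℤ (ℤ.[1+m]⊖[1+n]≡m⊖n m n) ⟩
    fromℤ (m ⊖ n)                           ≈⟨ fromℤ-⊖ m n ⟩
    -- Pad with 1 - 1 and give one summand to each term, which restores both successors.
    fromℕ m - fromℕ n                       ≈⟨ +-identityˡ _ ⟨
    0# + (fromℕ m - fromℕ n)                ≈⟨ +-congʳ (-‿inverseʳ 1#) ⟨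
    (1# - 1#) + (fromℕ m - fromℕ n)         ≈⟨ solve 4 (λ a b c d → (a :+ b) :+ (c :+ d) := (a :+ c) :+ (b :+ d)) refl _ _ _ _ ⟩
    (1# + fromℕ m) + (- 1# - fromℕ n)       ≈⟨ +-congˡ (-‿+-comm 1# (fromℕ n)) ⟩
    (1# + fromℕ m) - (1# + fromℕ n)         ∎

  fromℤ-+ : ∀ i j → fromℤ (i ℤ.+ j) ≈ fromℤ i + fromℤ j
  fromℤ-+ (+ m)    (+ n)    = ×-homo-+ 1# m n
  fromℤ-+ (+ m)    -[1+ n ] = fromℤ-⊖ m (suc n)
  fromℤ-+ -[1+ m ] (+ n)    = trans (fromℤ-⊖ n (suc m)) (+-comm _ _)
  fromℤ-+ -[1+ m ] -[1+ n ] = begin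
    - fromℕ (suc (suc (m ℕ.+ n)))      ≡⟨ ≡.cong (λ k → - fromℕ (suc k)) (ℕ.+-suc m n) ⟨
    - fromℕ (suc m ℕ.+ suc n)          ≈⟨ -‿cong (×-homo-+ 1# (suc m) (suc n)) ⟩
    - (fromℕ (suc m) + fromℕ (suc n))  ≈⟨ -‿+-comm _ _ ⟨
    - fromℕ (suc m) - fromℕ (suc n)    ∎

  -- The Stirling recurrence multiplies only by -n, so this case together with `fromℤ-neg` stands in
  -- for full multiplicativity.
  fromℤ-*+ : ∀ i n → fromℤ (i ℤ.* + n) ≈ n × fromℤ i
  fromℤ-*+ i zero    = reflexive (≡.cong fromℤ (ℤ.*-zeroʳ i))
  fromℤ-*+ i (suc n) = begin
    fromℤ (i ℤ.* + suc n)        ≡⟨ ≡.cong fromℤ (ℤ.*-suc i (+ n)) ⟩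
    fromℤ (i ℤ.+ i ℤ.* + n)      ≈⟨ fromℤ-+ i (i ℤ.* + n) ⟩
    fromℤ i + fromℤ (i ℤ.* + n)  ≈⟨ +-congˡ (fromℤ-*+ i n) ⟩
    fromℤ i + n × fromℤ i        ∎

  private
    s₁ : ℕ → ℕ → Carrier
    s₁ n m = fromℤ (S₁ n m)

  fromℤ-S₁-suc : ∀ n m → s₁ (suc n) m ≈ shift (s₁ n) m + - fromℕ n * s₁ n m
  fromℤ-S₁-suc n m = begin
    s₁ (suc n) m                                                ≡⟨ ≡.cong fromℤ (S₁-suc n m) ⟩
    fromℤ (S₁ n m ℤ.* ℤ.- (+ n) ℤ.+ shiftℤ (S₁ n) m)            ≈⟨ fromℤ-+ (S₁ n m ℤ.* ℤ.- (+ n)) _ ⟩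
    fromℤ (S₁ n m ℤ.* ℤ.- (+ n)) + fromℤ (shiftℤ (S₁ n) m)      ≈⟨ +-comm _ _ ⟩
    fromℤ (shiftℤ (S₁ n) m) + fromℤ (S₁ n m ℤ.* ℤ.- (+ n))      ≈⟨ +-cong (fromℤ-shift m) scaled ⟩
    shift (s₁ n) m + - fromℕ n * s₁ n m                         ∎
    where
    fromℤ-shift : ∀ m → fromℤ (shiftℤ (S₁ n) m) ≈ shift (s₁ n) m
    fromℤ-shift zero    = refl
    fromℤ-shift (suc m) = refl

    scaled : fromℤ (S₁ n m ℤ.* ℤ.- (+ n)) ≈ - fromℕ n * s₁ n m
    scaled = begin
      fromℤ (S₁ n m ℤ.* ℤ.- (+ n))    ≡⟨ ≡.cong fromℤ (ℤ.neg-distribʳ-* (S₁ n m) (+ n)) ⟨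
      fromℤ (ℤ.- (S₁ n m ℤ.* + n))    ≈⟨ fromℤ-neg (S₁ n m ℤ.* + n) ⟩
      - fromℤ (S₁ n m ℤ.* + n)        ≈⟨ -‿cong (fromℤ-*+ (S₁ n m) n) ⟩
      - (n × s₁ n m)                  ≈⟨ -‿cong (×-congʳ n (*-identityˡ _)) ⟨
      - (n × (1# * s₁ n m))           ≈⟨ -‿cong (×-assoc-* n 1# _) ⟨
      - (fromℕ n * s₁ n m)            ≈⟨ -‿distribˡ-* _ _ ⟩
      - fromℕ n * s₁ n m              ∎

  -- For p = ∑ₘ aₘ xᵐ of degree at most n and `f m` = aₘ yᵐ, this is lⁿ p(y / l) written without
  -- division, so it makes sense for every l, including 0.
  homogenize : Carrier → ℕ → (ℕ → Carrier) → Carrier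
  homogenize l n f = ∑[ m ≤ n ] (l ^ (n ∸ m) * f m)

  homogenize-cong : ∀ l n {f g} → (∀ m → f m ≈ g m) → homogenize l n f ≈ homogenize l n g
  homogenize-cong l n f≈g = sum-cong-≋ {suc n} (λ i → *-congˡ {l ^ (n ∸ toℕ i)} (f≈g (toℕ i)))

  homogenize-+ : ∀ l n f g →
    homogenize l n (λ m → f m + g m) ≈ homogenize l n f + homogenize l n g
  homogenize-+ l n f g =
    trans (sum-cong-≋ {suc n} (λ i → distribˡ (l ^ (n ∸ toℕ i)) (f (toℕ i)) (g (toℕ i))))
          (∑-distrib-+ {suc n} (λ i → l ^ (n ∸ toℕ i) * f (toℕ i)) (λ i → l ^ (n ∸ toℕ i) * g (toℕ i)))

  homogenize-* : ∀ l n a f → homogenize l n (λ m → a * f m) ≈ a * homogenize l n f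
  homogenize-* l n a f = sym (trans (*-distribˡ-sum {suc n} a (λ i → l ^ (n ∸ toℕ i) * f (toℕ i)))
    (sum-cong-≋ {suc n} (λ i → solve 3 (λ x y z → x :* (y :* z) := y :* (x :* z)) refl a (l ^ (n ∸ toℕ i)) (f (toℕ i)))))

  -- Each old term gains a factor l, and the new top term carries l⁰. Sums unfold at index 0 while
  -- the new term sits at the other end, hence the induction on the tail `f′`.
  homogenize-suc : ∀ l n f → homogenize l (suc n) f ≈ l * homogenize l n f + f (suc n)
  homogenize-suc l zero f = begin
    l * 1# * f 0 + (1# * f 1 + 0#)    ≈⟨ +-cong (*-assoc _ _ _) (trans (+-identityʳ _) (*-identityˡ _)) ⟩
    l * (1# * f 0) + f 1              ≈⟨ +-congʳ (*-congˡ (+-identityʳ _)) ⟨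
    l * (1# * f 0 + 0#) + f 1         ∎
  homogenize-suc l (suc n) f = begin
    l * l ^ suc n * f 0 + homogenize l (suc n) f′                 ≈⟨ +-congˡ (homogenize-suc l n f′) ⟩
    l * l ^ suc n * f 0 + (l * homogenize l n f′ + f′ (suc n))    ≈⟨ solve 5 (λ l a b c d → l :* a :* b :+ (l :* c :+ d) := l :* (a :* b :+ c) :+ d) refl _ _ _ _ _ ⟩
    l * (l ^ suc n * f 0 + homogenize l n f′) + f′ (suc n)        ∎
    where
    f′ : ℕ → Carrier
    f′ m = f (suc m)

  -- The term at 0 vanishes, and `suc n ∸ suc m` computes to `n ∸ m`, so the remaining terms already
  -- agree.
  homogenize-shift : ∀ l n f → homogenize l (suc n) (shift f) ≈ homogenize l n f
  homogenize-shift l n f = trans (+-congʳ (zeroʳ _)) (+-identityˡ _)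

  -- This is (y | l)ₙ = lⁿ (y / l)ₙ without division. In the induction the new factor is y - n l:
  -- its y moves the coefficients up by a shift, its l raises the degree of homogenization, and the
  -- two parts recombine by the Stirling recurrence.
  falling≈homogenize : ∀ y l n → falling y l n ≈ homogenize l n (λ m → y ^ m * s₁ n m)
  falling≈homogenize y l zero = sym (begin
    1# * (1# * (1# + 0#)) + 0#  ≈⟨ +-identityʳ _ ⟩
    1# * (1# * (1# + 0#))       ≈⟨ *-identityˡ _ ⟩
    1# * (1# + 0#)              ≈⟨ *-identityˡ _ ⟩
    1# + 0#                     ≈⟨ +-identityʳ _ ⟩
    1#                          ∎)
  falling≈homogenize y l (suc n) = begin
    falling y l n * (y - n × l)                                      ≈⟨ *-congʳ (falling≈homogenize y l n) ⟩
    h * (y - n × l)                                                  ≈⟨ *-congˡ (+-congˡ -[n×l]) ⟩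
    h * (y + - fromℕ n * l)                                          ≈⟨ solve 4 (λ h y a l → h :* (y :+ a :* l) := y :* h :+ a :* (l :* h)) refl _ _ _ _ ⟩
    -- Make room for the term of `g` at `suc n`, which is zero since (x)ₙ has degree n. With it, l h
    -- becomes the homogenization in degree n + 1.
    y * h + - fromℕ n * (l * h)                                      ≈⟨ +-congˡ (*-congˡ (+-identityʳ _)) ⟨
    y * h + - fromℕ n * (l * h + 0#)                                 ≈⟨ +-congˡ (*-congˡ (+-congˡ g[1+n]≈0)) ⟨
    y * h + - fromℕ n * (l * h + g (suc n))                          ≈⟨ +-cong (homogenize-* l n y g) (*-congˡ (homogenize-suc l n g)) ⟨
    homogenize l n (λ m → y * g m) + - fromℕ n * homogenize l (suc n) g
                                                                     ≈⟨ +-cong (homogenize-shift l n (λ m → y * g m)) (homogenize-* l (suc n) _ g) ⟨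
    homogenize l (suc n) (shift (λ m → y * g m)) + homogenize l (suc n) (λ m → - fromℕ n * g m)
                                                                     ≈⟨ homogenize-+ l (suc n) (shift (λ m → y * g m)) (λ m → - fromℕ n * g m) ⟨
    homogenize l (suc n) (λ m → shift (λ m → y * g m) m + - fromℕ n * g m)
                                                                     ≈⟨ homogenize-cong l (suc n) g-suc ⟨
    homogenize l (suc n) (λ m → y ^ m * s₁ (suc n) m)                ∎
    where
    g : ℕ → Carrier
    g m = y ^ m * s₁ n m

    h : Carrier
    h = homogenize l n g

    -[n×l] : - (n × l) ≈ - fromℕ n * l
    -[n×l] = begin
      - (n × l)         ≈⟨ -‿cong (×-congʳ n (*-identityˡ l)) ⟨
      - (n × (1# * l))  ≈⟨ -‿cong (×-assoc-* n 1# l) ⟨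
      - (fromℕ n * l)   ≈⟨ -‿distribˡ-* _ _ ⟩
      - fromℕ n * l     ∎

    g[1+n]≈0 : g (suc n) ≈ 0#
    g[1+n]≈0 = trans (*-congˡ (reflexive (≡.cong fromℤ (n<m⇒S₁≡0 (ℕ.n<1+n n))))) (zeroʳ _)

    shift-power : ∀ m → y ^ m * shift (s₁ n) m ≈ shift (λ m → y * g m) m
    shift-power zero    = zeroʳ _
    shift-power (suc m) = *-assoc _ _ _

    g-suc : ∀ m → y ^ m * s₁ (suc n) m ≈ shift (λ m → y * g m) m + - fromℕ n * g m
    g-suc m = begin
      y ^ m * s₁ (suc n) m                                   ≈⟨ *-congˡ (fromℤ-S₁-suc n m) ⟩
      y ^ m * (shift (s₁ n) m + - fromℕ n * s₁ n m)          ≈⟨ solve 4 (λ p s a t → p :* (s :+ a :* t) := p :* s :+ a :* (p :* t)) refl _ _ _ _ ⟩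
      y ^ m * shift (s₁ n) m + - fromℕ n * g m               ≈⟨ +-congʳ (shift-power m) ⟩
      shift (λ m → y * g m) m + - fromℕ n * g m              ∎

-- Coefficients in x of the extended Bell polynomials and of the Stirling sums.

module ExtendedBell {c ℓ} (A : ℚAlgebra c ℓ) where
  open ℚAlgebra A
  open DegenerateBell A using (Bel; bellSeries; extBel; degExp; falling; fromℕ; fromℤ; con; _^_)
    renaming (_*_ to _*ₚ_; _×_ to _×ₚ_)
  open Polynomial rawRing using (Poly; coeff)
  open FiniteSum (CommutativeRing.+-rawMonoid commutativeRing)
  open PolynomialCoefficients commutativeRing
  open FallingExpansion commutativeRing using (homogenize; falling≈homogenize)
  open SemiringMult semiring
  open SemiringSum semiring using (sum-cong-≋; *-distribˡ-sum)
  open CommutativeMonoidMult +-commutativeMonoid using (×-distrib-+)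
  open SemiringSolver commutativeSemiring using (solve; _:=_; _:*_)
  open SetoidReasoning setoid

  private
    ∑≤ₚ : ℕ → (ℕ → Poly) → Poly
    ∑≤ₚ = DegenerateBell.∑≤ A

  1/!_ : ℕ → Carrier
  1/! n = (1/ (n !)) {{n !≢0}}

  ∑≤-cong : ∀ n {f g : ℕ → Carrier} → (∀ {k} → k ≤ n → f k ≈ g k) → ∑≤ n f ≈ ∑≤ n g
  ∑≤-cong n f≈g = sum-cong-≋ {suc n} (λ i → f≈g (toℕ≤pred[n] i))

  ×-distrib-∑≤ : ∀ a n f → a × ∑≤ n f ≈ ∑[ k ≤ n ] (a × f k)
  ×-distrib-∑≤ a zero    f = trans (×-distrib-+ _ _ a) (+-congˡ (×-zeroʳ a))
    where
    ×-zeroʳ : ∀ a → a × 0# ≈ 0#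
    ×-zeroʳ zero    = refl
    ×-zeroʳ (suc a) = trans (+-identityˡ _) (×-zeroʳ a)
  ×-distrib-∑≤ a (suc n) f =
    trans (×-distrib-+ _ _ a) (+-congˡ (×-distrib-∑≤ a n (λ k → f (suc k))))

  k!×1/k!*x≈x : ∀ k x → (k !) × (1/! k * x) ≈ x
  k!×1/k!*x≈x k x = begin
    (k !) × (1/! k * x)         ≈⟨ ×-assoc-* (k !) _ x ⟨
    -- A unit is inserted to turn the multiple of `1/! k` into a product with `(k !) × 1#`, the form
    -- in which `1/-inverse` is stated.
    ((k !) × 1/! k) * x         ≈⟨ *-congʳ (×-congʳ (k !) (*-identityˡ _)) ⟨
    ((k !) × (1# * 1/! k)) * x  ≈⟨ *-congʳ (×-assoc-* (k !) 1# _) ⟨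
    ((k !) × 1# * 1/! k) * x    ≈⟨ *-congʳ (1/-inverse (k !) {{k !≢0}}) ⟩
    1# * x                    ≈⟨ *-identityˡ x ⟩
    x                         ∎

  -- Split n! as (n C k) (n - k)! k! and cancel `k !` against `1/! k`. The factor (n - k)! stays
  -- with `b`, which is a plain series coefficient, and turns it into an exponential one.
  binomial-convolution : ∀ {n k} → k ≤ n → ∀ a b →
    (n !) × (a * 1/! k * b) ≈ (n C k) × (((n ∸ k) !) × b) * a
  binomial-convolution {n} {k} k≤n a b = begin
    (n !) × (a * 1/! k * b)                                 ≡⟨ ≡.cong (_× _) (nCk*[n∸k]!*k!≡n! k≤n) ⟨
    ((n C k) ℕ.* (n ∸ k) ! ℕ.* k !) × (a * 1/! k * b)     ≈⟨ ×-assocˡ _ ((n C k) ℕ.* (n ∸ k) !) (k !) ⟨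
    ((n C k) ℕ.* (n ∸ k) !) × ((k !) × (a * 1/! k * b))     ≈⟨ ×-congʳ ((n C k) ℕ.* (n ∸ k) !) (×-congʳ (k !) (solve 3 (λ a u b → a :* u :* b := u :* (b :* a)) refl a (1/! k) b)) ⟩
    ((n C k) ℕ.* (n ∸ k) !) × ((k !) × (1/! k * (b * a)))   ≈⟨ ×-congʳ ((n C k) ℕ.* (n ∸ k) !) (k!×1/k!*x≈x k (b * a)) ⟩
    ((n C k) ℕ.* (n ∸ k) !) × (b * a)                     ≈⟨ ×-assoc-* ((n C k) ℕ.* (n ∸ k) !) b a ⟨
    ((n C k) ℕ.* (n ∸ k) !) × b * a                       ≈⟨ *-congʳ (×-assocˡ b (n C k) _) ⟨
    (n C k) × (((n ∸ k) !) × b) * a                         ∎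

  -- The Cauchy product of the two series, taken at one power of x. The coefficients of `degExp` are
  -- constant polynomials, so multiplying by them only scales.
  coeff-extBel : ∀ l r n j →
    coeff (extBel l r n) j ≈
      ∑[ k ≤ n ] ((n C k) × coeff (Bel l (n ∸ k)) j * falling (fromℕ r) l k)
  coeff-extBel l r n j = begin
    coeff (extBel l r n) j                                         ≈⟨ coeff-× (n !) (∑≤ₚ n term) j ⟩
    (n !) × coeff (∑≤ₚ n term) j                                     ≈⟨ ×-congʳ (n !) (coeff-∑≤ n term j) ⟩
    (n !) × ∑[ k ≤ n ] coeff (term k) j                              ≈⟨ ×-distrib-∑≤ (n !) n (λ k → coeff (term k) j) ⟩
    ∑[ k ≤ n ] ((n !) × coeff (term k) j)                            ≈⟨ ∑≤-cong n coeff-term ⟩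
    ∑[ k ≤ n ] ((n C k) × coeff (Bel l (n ∸ k)) j * falling (fromℕ r) l k)  ∎
    where
    term : ℕ → Poly
    term k = degExp l (fromℕ r) k *ₚ bellSeries l (n ∸ k)

    coeff-term : ∀ {k} → k ≤ n →
      (n !) × coeff (term k) j ≈ (n C k) × coeff (Bel l (n ∸ k)) j * falling (fromℕ r) l k
    coeff-term {k} k≤n = begin
      (n !) × coeff (term k) j                      ≈⟨ ×-congʳ (n !) (coeff-con-*ₚ _ (bellSeries l (n ∸ k)) j) ⟩
      -- The `+ 0#` is the residue of computing the product of the constant polynomials `con F` and
      -- `con (1/! k)`.
      (n !) × ((F * 1/! k + 0#) * b)                ≈⟨ ×-congʳ (n !) (*-congʳ (+-identityʳ _)) ⟩
      (n !) × (F * 1/! k * b)                       ≈⟨ binomial-convolution k≤n F b ⟩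
      (n C k) × (((n ∸ k) !) × b) * F               ≈⟨ *-congʳ (×-congʳ (n C k) (coeff-× ((n ∸ k) !) (bellSeries l (n ∸ k)) j)) ⟨
      (n C k) × coeff (Bel l (n ∸ k)) j * F       ∎
      where
      F b : Carrier
      F = falling (fromℕ r) l k
      b = coeff (bellSeries l (n ∸ k)) j

  -- The constant factors only scale the coefficient of `p`, so `a × coeff p j` comes out of the sum
  -- over m. What remains is the homogenized form of the falling factorial.
  coeff-Stirling : ∀ l r a p k j →
    coeff (∑≤ₚ k (λ m → a ×ₚ (p *ₚ con (l ^ (k ∸ m)) *ₚ con (fromℕ r ^ m) *ₚ con (fromℤ (S₁ k m))))) j
      ≈ a × coeff p j * falling (fromℕ r) l k
  coeff-Stirling l r a p k j = begin
    coeff (∑≤ₚ k (λ m → a ×ₚ term m)) j                             ≈⟨ coeff-∑≤ k (λ m → a ×ₚ term m) j ⟩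
    ∑[ m ≤ k ] coeff (a ×ₚ term m) j                                ≈⟨ ∑≤-cong k (λ {m} _ → coeff-term m) ⟩
    ∑[ m ≤ k ] (a × coeff p j * (l ^ (k ∸ m) * (fromℕ r ^ m * fromℤ (S₁ k m))))
                                                                    ≈⟨ *-distribˡ-sum {suc k} (a × coeff p j)
                                                                         (λ i → l ^ (k ∸ toℕ i) * (fromℕ r ^ toℕ i * fromℤ (S₁ k (toℕ i)))) ⟨
    a × coeff p j * homogenize l k (λ m → fromℕ r ^ m * fromℤ (S₁ k m))
                                                                    ≈⟨ *-congˡ (falling≈homogenize (fromℕ r) l k) ⟨
    a × coeff p j * falling (fromℕ r) l k                           ∎
    where
    term : ℕ → Poly
    term m = p *ₚ con (l ^ (k ∸ m)) *ₚ con (fromℕ r ^ m) *ₚ con (fromℤ (S₁ k m))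

    coeff-term : ∀ m → coeff (a ×ₚ term m) j
      ≈ a × coeff p j * (l ^ (k ∸ m) * (fromℕ r ^ m * fromℤ (S₁ k m)))
    coeff-term m = begin
      coeff (a ×ₚ term m) j                ≈⟨ coeff-× a (term m) j ⟩
      a × coeff (term m) j                 ≈⟨ ×-congʳ a (trans (coeff-*ₚ-con (p *ₚ con L *ₚ con P) S j)
                                                (*-congʳ (trans (coeff-*ₚ-con (p *ₚ con L) P j)
                                                  (*-congʳ (coeff-*ₚ-con p L j))))) ⟩
      a × (coeff p j * L * P * S)          ≈⟨ ×-congʳ a (solve 4 (λ b l p s → b :* l :* p :* s := b :* (l :* (p :* s))) refl _ _ _ _) ⟩
      a × (coeff p j * (L * (P * S)))      ≈⟨ ×-assoc-* a _ _ ⟨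
      a × coeff p j * (L * (P * S))        ∎
      where
      L P S : Carrier
      L = l ^ (k ∸ m)
      P = fromℕ r ^ m
      S = fromℤ (S₁ k m)

theorem2p5 : ∀ {c ℓ} (A : ℚAlgebra c ℓ) →
    let open DegenerateBell A in
    (l : Scalar) (r n : ℕ) →
    extBel l r n ≈
    ∑[ k ≤ n ] (∑[ m ≤ k ]
    ((n C k) × (Bel l (n ∸ k) * con (l ^ (k ∸ m)) * con (fromℕ r ^ m) * con (fromℤ (S₁ k m)))))
-- Both sides meet at the convolution with `falling`: the left through the product of series, the
-- right by collapsing each inner sum over m.
theorem2p5 A l r n j = begin
  coeff (extBel l r n) j                                                       ≈⟨ coeff-extBel l r n j ⟩
  ∑≤ₛ n (λ k → (n C k) ×ₛ coeff (Bel l (n ∸ k)) j *ₛ falling (fromℕ r) l k)    ≈⟨ ∑≤-cong n (λ {k} _ → coeff-Stirling l r (n C k) (Bel l (n ∸ k)) k j) ⟨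
  ∑≤ₛ n (λ k → coeff (term k) j)                                               ≈⟨ coeff-∑≤ n term j ⟨
  coeff (∑≤ n term) j                                                          ∎
  where
  open ExtendedBell A
  open ℚAlgebra A using (commutativeRing; setoid) renaming (_*_ to _*ₛ_)
  open RingExtras (ℚAlgebra.rawRing A) using () renaming (_×_ to _×ₛ_)
  open FiniteSum (CommutativeRing.+-rawMonoid commutativeRing) using () renaming (∑≤ to ∑≤ₛ)
  open PolynomialCoefficients commutativeRing using (coeff-∑≤)
  open Polynomial (ℚAlgebra.rawRing A) using (coeff)
  open DegenerateBell A
  open SetoidReasoning setoid

  term : ℕ → Poly
  term k = ∑≤ k λ m →
    (n C k) × (Bel l (n ∸ k) * con (l ^ (k ∸ m)) * con (fromℕ r ^ m) * con (fromℤ (S₁ k m)))
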